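{- A Sturmian word $w$ over $\{a,b\}$ is non-quasiperiodic if and only if $w$ is an infinite Lyndon word over $\{a \prec b\}$ or over $\{b \prec a\}$.
   Context: Words are over the alphabet $\{a,b\}$; $|u|_a$ is the number of occurrences of $a$ in $u$. A word is balanced if $||u|_a-|v|_a|\le 1$ for any two of its factors $u,v$ of the same length. An infinite (i.e. right-infinite) word is ultimately periodic if it equals $uv^\omega$ for finite words $u$ and $v\neq\varepsilon$. A Sturmian word is an infinite balanced word over $\{a,b\}$ that is not ultimately periodic. An infinite word $w$ is quasiperiodic if there exist a finite word $u$ (a quasiperiod of $w$) and finite words $(p_n)_{n\ge 0}$ with $p_0=\varepsilon$ such that, for all $n\ge 0$, $0<|p_{n+1}|-|p_n|\le |u|$ and $p_nu$ is a prefix of $w$. It is non-quasiperiodic otherwise. $\{a\prec b\}$ denotes the alphabet $\{a,b\}$ with the total order $a\prec b$ (similarly $\{b\prec a\}$); the order is extended to words lexicographically. An infinite word $w'$ is a proper suffix of an infinite word $w$ if $w=uw'$ for some finite word $u\ne\varepsilon$. An infinite word is an infinite Lyndon word (for the given order) if it is strictly smaller, in the lexicographic order, than all its proper suffixes. -}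

module Defs where

open import Data.List.Base using (List; []; _∷_; _++_; length; lookup)
open import Data.List.NonEmpty.Base using (List⁺; _∷_)
open import Data.Nat.Base using (ℕ; zero; suc; _+_; _≤_; _<_; ∣_-_∣)
open import Data.Nat.DivMod using (_mod_)
open import Data.Product.Base using (_×_; ∃-syntax; Σ-syntax)
open import Function.Base using (flip)
open import Level using (0ℓ)
open import Relation.Binary.Core using (Rel)
open import Relation.Binary.PropositionalEquality using (_≡_; _≢_; _≗_)
open import Relation.Nullary using (¬_)

data Letter : Set where
  a b : Letter

Word : Set
Word = List Letter

-- Infinite words are compared letter by letter, that is, up to _≗_.
ωWord : Set
ωWord = ℕ → Letter

infixr 5 _⧺_

_⧺_ : Word → ωWord → ωWord
([]      ⧺ w) n       = w n
((x ∷ u) ⧺ w) zero    = x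
((x ∷ u) ⧺ w) (suc n) = (u ⧺ w) n

infix 8 _^ω

_^ω : List⁺ Letter → ωWord
((x ∷ v) ^ω) n = lookup (x ∷ v) (n mod length (x ∷ v))

∣_∣ₐ : Word → ℕ
∣ []    ∣ₐ = 0
∣ a ∷ u ∣ₐ = suc ∣ u ∣ₐ
∣ b ∷ u ∣ₐ = ∣ u ∣ₐ

Prefix : Word → ωWord → Set
Prefix u w = ∃[ w′ ] w ≗ u ⧺ w′

Factor : Word → ωWord → Set
Factor u w = ∃[ p ] ∃[ w′ ] w ≗ p ⧺ u ⧺ w′

ProperSuffix : ωWord → ωWord → Set
ProperSuffix w′ w = ∃[ u ] (u ≢ [] × w ≗ u ⧺ w′)

Balanced : ωWord → Set
Balanced w = ∀ u v → Factor u w → Factor v w → length u ≡ length v →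
             ∣ ∣ u ∣ₐ - ∣ v ∣ₐ ∣ ≤ 1

UltimatelyPeriodic : ωWord → Set
UltimatelyPeriodic w = ∃[ u ] ∃[ v ] w ≗ u ⧺ v ^ω

Sturmian : ωWord → Set
Sturmian w = Balanced w × ¬ UltimatelyPeriodic w

-- The bounds 0 < |pₙ₊₁| - |pₙ| ≤ |u| are written without subtraction.
Quasiperiod : Word → ωWord → Set
Quasiperiod u w =
  Σ[ p ∈ (ℕ → Word) ]
    (p 0 ≡ [] ×
     (∀ n → length (p n) < length (p (suc n)) ×
            length (p (suc n)) ≤ length (p n) + length u ×
            Prefix (p n ++ u) w))

Quasiperiodic : ωWord → Set
Quasiperiodic w = ∃[ u ] Quasiperiod u w

NonQuasiperiodic : ωWord → Set
NonQuasiperiodic w = ¬ Quasiperiodic w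

-- The two total orders on the alphabet, given by their strict parts.
data _≺ᵃᵇ_ : Rel Letter 0ℓ where
  a≺b : a ≺ᵃᵇ b

_≺ᵇᵃ_ : Rel Letter 0ℓ
_≺ᵇᵃ_ = flip _≺ᵃᵇ_

Lex : Rel Letter 0ℓ → Rel ωWord 0ℓ
Lex _≺_ w w′ = ∃[ n ] ((∀ i → i < n → w i ≡ w′ i) × w n ≺ w′ n)

Lyndon : Rel Letter 0ℓ → ωWord → Set
Lyndon _≺_ w = ∀ w′ → ProperSuffix w′ w → Lex _≺_ w w′

{-# OPTIONS --safe #-}

-- A Lyndon word has arbitrarily long unbordered prefixes, so it is not covered
-- by the occurrences of any of its prefixes.
--
-- Conversely, let w be Sturmian and not quasiperiodic, with no factor bb (else
-- exchange the letters). If w starts with b then w = R(x), and if w starts with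
-- aa then w = a R(x), where R is the morphism a ↦ a, b ↦ ba; a prefix ab would
-- make w quasiperiodic. In both cases x is again Sturmian and not quasiperiodic
-- and starts with the same letter as w, and a comparison of x with its suffix at
-- n is carried by R to one of w with its suffix at |R(x₀…xₙ₋₁)|. Induction on the
-- position of the suffix shows that w is the smallest of its suffixes for the
-- order in which its first letter comes first.

module Submission where

open import Defs
open import Axiom.ExcludedMiddle using (ExcludedMiddle)
open import Data.Empty using (⊥)
open import Data.Fin.Base using (Fin; zero; suc; toℕ)
open import Data.Fin.Properties using (toℕ-fromℕ<)
open import Data.List.Base using ([]; _∷_; _++_; length; lookup)
open import Data.List.NonEmpty.Base using (_∷_)
open import Data.Nat.Base
open import Data.Nat.DivMod using (_%_; _/_; _mod_; m≡m%n+[m/n]*n; m%n<n)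
open import Data.Nat.Induction using (<-rec)
open import Data.Nat.Properties
open import Data.Nat.Tactic.RingSolver using (solve-∀)
open import Data.Product.Base using (_×_; _,_; proj₁; proj₂; ∃-syntax; Σ-syntax)
open import Data.Sum.Base using (_⊎_; inj₁; inj₂)
open import Function.Base using (_∘_)
open import Function.Bundles using (_⇔_; mk⇔)
open import Level using (0ℓ)
open import Relation.Binary.Core using (Rel)
open import Relation.Binary.Definitions using (Asymmetric; tri<; tri≈; tri>)
open import Relation.Binary.PropositionalEquality
open import Relation.Nullary using (¬_; yes; no; contradiction)

-- Factors, prefixes and suffixes of infinite words by positions.

drop : ℕ → ωWord → ωWord
drop i w n = w (i + n)

factor : ωWord → ℕ → ℕ → Word
factor w i zero    = []
factor w i (suc n) = w i ∷ factor w (suc i) n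

length-factor : ∀ w i n → length (factor w i n) ≡ n
length-factor w i zero    = refl
length-factor w i (suc n) = cong suc (length-factor w (suc i) n)

drop≗factor⧺drop : ∀ w i n → drop i w ≗ factor w i n ⧺ drop (i + n) w
drop≗factor⧺drop w i zero    k       = cong (λ m → w (m + k)) (sym (+-identityʳ i))
drop≗factor⧺drop w i (suc n) zero    = cong w (+-identityʳ i)
drop≗factor⧺drop w i (suc n) (suc k) = begin
  w (i + suc k)                                     ≡⟨ cong w (+-suc i k) ⟩
  w (suc i + k)                                     ≡⟨ drop≗factor⧺drop w (suc i) n k ⟩
  (factor w (suc i) n ⧺ drop (suc i + n) w) k       ≡⟨ cong (λ m → (factor w (suc i) n ⧺ drop m w) k) (+-suc i n) ⟨
  (factor w (suc i) n ⧺ drop (i + suc n) w) k       ∎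
  where open ≡-Reasoning

⧺-cong : ∀ u {x y} → x ≗ y → u ⧺ x ≗ u ⧺ y
⧺-cong []      x≗y n       = x≗y n
⧺-cong (_ ∷ u) x≗y zero    = refl
⧺-cong (_ ∷ u) x≗y (suc n) = ⧺-cong u x≗y n

++-⧺ : ∀ u v x → (u ++ v) ⧺ x ≗ u ⧺ v ⧺ x
++-⧺ []      v x n       = refl
++-⧺ (_ ∷ u) v x zero    = refl
++-⧺ (_ ∷ u) v x (suc n) = ++-⧺ u v x n

⧺-drop : ∀ u x n → (u ⧺ x) (length u + n) ≡ x n
⧺-drop []      x n = refl
⧺-drop (_ ∷ u) x n = ⧺-drop u x n

⧺-take : ∀ u x y n → n < length u → (u ⧺ x) n ≡ (u ⧺ y) n
⧺-take (_ ∷ u) x y zero    _         = refl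
⧺-take (_ ∷ u) x y (suc n) (s≤s n<u) = ⧺-take u x y n n<u

factor-cong : ∀ {w x} i j n → (∀ t → t < n → w (i + t) ≡ x (j + t)) → factor w i n ≡ factor x j n
factor-cong         i j zero    eq = refl
factor-cong {w} {x} i j (suc n) eq = cong₂ _∷_
  (trans (cong w (sym (+-identityʳ i))) (trans (eq 0 (s≤s z≤n)) (cong x (+-identityʳ j))))
  (factor-cong (suc i) (suc j) n λ t t<n →
    trans (cong w (sym (+-suc i t))) (trans (eq (suc t) (s≤s t<n)) (cong x (+-suc j t))))

factor-isFactor : ∀ w i n → Factor (factor w i n) w
factor-isFactor w i n = factor w 0 i , drop (i + n) w , λ k →
  trans (drop≗factor⧺drop w 0 i k) (⧺-cong (factor w 0 i) (drop≗factor⧺drop w i n) k)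

-- Quasiperiodicity by positions.

OccursAt : ωWord → ℕ → ℕ → Set
OccursAt w ℓ i = ∀ t → t < ℓ → w (i + t) ≡ w t

-- As `p 0` is empty, a quasiperiod is itself a prefix of `w`. So its length `ℓ` determines it, and
-- each prefix `p n` is determined by its length `q n`.
Covered : ωWord → Set
Covered w = ∃[ ℓ ] Σ[ q ∈ (ℕ → ℕ) ] (q 0 ≡ 0 ×
  (∀ n → q n < q (suc n) × q (suc n) ≤ q n + ℓ × OccursAt w ℓ (q n)))

covered⇒quasiperiodic : ∀ {w} → Covered w → Quasiperiodic w
covered⇒quasiperiodic {w} (ℓ , q , q0≡0 , step) =
  factor w 0 ℓ , (λ n → factor w 0 (q n)) , cong (factor w 0) q0≡0 , λ n →
    subst₂ _<_ (sym (len (q n))) (sym (len (q (suc n)))) (proj₁ (step n)) ,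
    subst₂ _≤_ (sym (len (q (suc n)))) (sym (cong₂ _+_ (len (q n)) (len ℓ))) (proj₁ (proj₂ (step n))) ,
    prefix (q n) (proj₂ (proj₂ (step n)))
  where
  len = length-factor w 0
  prefix : ∀ i → OccursAt w ℓ i → Prefix (factor w 0 i ++ factor w 0 ℓ) w
  prefix i occ = drop (i + ℓ) w , λ k → begin
    w k                                                  ≡⟨ drop≗factor⧺drop w 0 i k ⟩
    (factor w 0 i ⧺ drop i w) k                          ≡⟨ ⧺-cong (factor w 0 i) (drop≗factor⧺drop w i ℓ) k ⟩
    (factor w 0 i ⧺ factor w i ℓ ⧺ drop (i + ℓ) w) k
      ≡⟨ cong (λ u → (factor w 0 i ⧺ u ⧺ drop (i + ℓ) w) k) (factor-cong i 0 ℓ occ) ⟩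
    (factor w 0 i ⧺ factor w 0 ℓ ⧺ drop (i + ℓ) w) k     ≡⟨ ++-⧺ (factor w 0 i) (factor w 0 ℓ) (drop (i + ℓ) w) k ⟨
    ((factor w 0 i ++ factor w 0 ℓ) ⧺ drop (i + ℓ) w) k  ∎
    where open ≡-Reasoning

quasiperiodic⇒covered : ∀ {w} → Quasiperiodic w → Covered w
quasiperiodic⇒covered {w} (u , p , p0≡[] , step) =
  length u , length ∘ p , cong length p0≡[] , λ n →
    proj₁ (step n) , proj₁ (proj₂ (step n)) , λ t t<u →
      trans (at n t t<u) (sym (at₀ t t<u))
  where
  open ≡-Reasoning
  at : ∀ n t → t < length u → w (length (p n) + t) ≡ (u ⧺ w) t
  at n t t<u with proj₂ (proj₂ (step n))
  ... | x , w≗ = begin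
    w (length (p n) + t)                ≡⟨ w≗ _ ⟩
    ((p n ++ u) ⧺ x) (length (p n) + t) ≡⟨ ++-⧺ (p n) u x _ ⟩
    (p n ⧺ u ⧺ x) (length (p n) + t)    ≡⟨ ⧺-drop (p n) (u ⧺ x) t ⟩
    (u ⧺ x) t                           ≡⟨ ⧺-take u x w t t<u ⟩
    (u ⧺ w) t                           ∎
  at₀ : ∀ t → t < length u → w t ≡ (u ⧺ w) t
  at₀ t t<u = trans (cong (λ v → w (length v + t)) (sym p0≡[])) (at 0 t t<u)

-- Ultimate periodicity by positions.

EventuallyPeriodic : ωWord → Set
EventuallyPeriodic w = ∃[ N ] ∃[ p ] (∀ d → w (d + N + suc p) ≡ w (d + N))

lookup-factor : ∀ w i n (k : Fin (length (factor w i n))) → lookup (factor w i n) k ≡ w (i + toℕ k)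
lookup-factor w i (suc n) zero    = cong w (sym (+-identityʳ i))
lookup-factor w i (suc n) (suc k) = trans (lookup-factor w (suc i) n k) (cong w (sym (+-suc i (toℕ k))))

periodic-* : ∀ (w : ωWord) p → (∀ n → w (n + p) ≡ w n) → ∀ k n → w (n + k * p) ≡ w n
periodic-* w p per zero    n = cong w (+-identityʳ n)
periodic-* w p per (suc k) n =
  trans (cong w (sym (+-assoc n p (k * p)))) (trans (periodic-* w p per k (n + p)) (per n))

eventuallyPeriodic⇒ultimatelyPeriodic : ∀ {w} → EventuallyPeriodic w → UltimatelyPeriodic w
eventuallyPeriodic⇒ultimatelyPeriodic {w} (N , p , per) =
  factor w 0 N , w N ∷ factor w (suc N) p , λ k →
    trans (drop≗factor⧺drop w 0 N k) (⧺-cong (factor w 0 N) tail k)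
  where
  v = factor w N (suc p)
  period : ∀ n → drop N w (n + length v) ≡ drop N w n
  period n = begin
    w (N + (n + length v)) ≡⟨ cong (λ m → w (N + (n + m))) (length-factor w N (suc p)) ⟩
    w (N + (n + suc p))    ≡⟨ cong w (+-assoc N n (suc p)) ⟨
    w (N + n + suc p)      ≡⟨ cong (λ m → w (m + suc p)) (+-comm N n) ⟩
    w (n + N + suc p)      ≡⟨ per n ⟩
    w (n + N)              ≡⟨ cong w (+-comm n N) ⟩
    w (N + n)              ∎
    where open ≡-Reasoning
  tail : drop N w ≗ (w N ∷ factor w (suc N) p) ^ω
  tail n = begin
    w (N + n)                                            ≡⟨ cong (drop N w) (m≡m%n+[m/n]*n n (length v)) ⟩
    drop N w (n % length v + n / length v * length v)    ≡⟨ periodic-* (drop N w) (length v) period (n / length v) _ ⟩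
    w (N + n % length v)                                 ≡⟨ cong (drop N w) (toℕ-fromℕ< (m%n<n n (length v))) ⟨
    w (N + toℕ (n mod length v))                         ≡⟨ lookup-factor w N (suc p) (n mod length v) ⟨
    lookup v (n mod length v)                            ∎
    where open ≡-Reasoning

-- Exchange of the letters, and balance by counts of b.

swap : Letter → Letter
swap a = b
swap b = a

swap-involutive : ∀ x → swap (swap x) ≡ x
swap-involutive a = refl
swap-involutive b = refl

swap-injective : ∀ {x y} → swap x ≡ swap y → x ≡ y
swap-injective {a} {a} _ = refl
swap-injective {b} {b} _ = refl

bump : Letter → ℕ → ℕ
bump a n = n
bump b n = suc n

countᵇ : ωWord → ℕ → ℕ
countᵇ w zero    = 0
countᵇ w (suc n) = bump (w n) (countᵇ w n)

-- |w[i..e)|_b ≤ 1 + |w[j..f)|_b whenever e - i = f - j, free of subtraction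
-- (and of the condition i ≤ e, which may be dropped by exchanging the roles).
BalancedCount : ωWord → Set
BalancedCount w = ∀ e f i j → e + j ≡ f + i →
  countᵇ w e + countᵇ w j ≤ suc (countᵇ w f + countᵇ w i)

balancedCount-from-windows : ∀ {w} →
  (∀ i j n → countᵇ w (i + n) + countᵇ w j ≤ suc (countᵇ w (j + n) + countᵇ w i)) →
  BalancedCount w
balancedCount-from-windows {w} window e f i j e+j≡f+i with ≤-total i e
... | inj₁ i≤e with m≤n⇒∃[o]m+o≡n i≤e
...   | n , refl = subst (λ m → countᵇ w (i + n) + countᵇ w j ≤ suc (countᵇ w m + countᵇ w i))
                         (+-cancelʳ-≡ i _ _ (trans (exchange i j n) e+j≡f+i)) (window i j n)
  where
  exchange : ∀ x y z → y + z + x ≡ x + z + y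
  exchange = solve-∀
balancedCount-from-windows {w} window e f i j e+j≡f+i | inj₂ e≤i with m≤n⇒∃[o]m+o≡n e≤i
...   | n , refl = subst₂ _≤_
                     (trans (+-comm (countᵇ w (f + n)) (countᵇ w e)) (cong (λ m → countᵇ w e + countᵇ w m) f+n≡j))
                     (cong suc (+-comm (countᵇ w (e + n)) (countᵇ w f)))
                     (window f e n)
  where
  regroup : ∀ x y z → x + z + y ≡ x + (y + z)
  regroup = solve-∀
  f+n≡j : f + n ≡ j
  f+n≡j = +-cancelʳ-≡ e _ _ (trans (regroup f e n) (trans (sym e+j≡f+i) (+-comm e j)))

countᵇ-swap : ∀ w n → countᵇ (swap ∘ w) n + countᵇ w n ≡ n
countᵇ-swap w zero = refl
countᵇ-swap w (suc n) with w n
... | a = cong suc (countᵇ-swap w n)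
... | b = trans (+-suc _ _) (cong suc (countᵇ-swap w n))

-- In windows of equal length the counts of a and of b are complementary, so the bound for one
-- letter is the bound for the other with the two windows exchanged.
balancedCount-swap : ∀ {w} → BalancedCount w → BalancedCount (swap ∘ w)
balancedCount-swap {w} bal e f i j e+j≡f+i = +-cancelʳ-≤ (B e + B j) _ _ (begin
  (A e + A j) + (B e + B j)     ≡⟨ interchange (A e) (A j) (B e) (B j) ⟩
  (A e + B e) + (A j + B j)     ≡⟨ cong₂ _+_ (countᵇ-swap w e) (countᵇ-swap w j) ⟩
  e + j                         ≡⟨ e+j≡f+i ⟩
  f + i                         ≡⟨ cong₂ _+_ (countᵇ-swap w f) (countᵇ-swap w i) ⟨
  (A f + B f) + (A i + B i)     ≡⟨ interchange (A f) (A i) (B f) (B i) ⟨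
  (A f + A i) + (B f + B i)     ≤⟨ +-monoʳ-≤ (A f + A i) (bal f e j i (sym e+j≡f+i)) ⟩
  (A f + A i) + suc (B e + B j) ≡⟨ +-suc _ _ ⟩
  suc (A f + A i) + (B e + B j) ∎)
  where
  open ≤-Reasoning
  A = countᵇ (swap ∘ w)
  B = countᵇ w
  interchange : ∀ x y z t → (x + y) + (z + t) ≡ (x + z) + (y + t)
  interchange = solve-∀

balancedCount-cong : ∀ {w x} → w ≗ x → BalancedCount w → BalancedCount x
balancedCount-cong {w} {x} w≗x bal e f i j eq =
  subst₂ _≤_ (cong₂ _+_ (same e) (same j)) (cong suc (cong₂ _+_ (same f) (same i))) (bal e f i j eq)
  where
  same : ∀ n → countᵇ w n ≡ countᵇ x n
  same zero    = refl
  same (suc n) = cong₂ bump (w≗x n) (same n)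

count-factor : ∀ w i n → ∣ factor w i n ∣ₐ + countᵇ (swap ∘ w) i ≡ countᵇ (swap ∘ w) (i + n)
count-factor w i zero = cong (countᵇ (swap ∘ w)) (sym (+-identityʳ i))
count-factor w i (suc n) with count-factor w (suc i) n
... | ih rewrite +-suc i n with w i
...   | a = trans (sym (+-suc _ _)) ih
...   | b = ih

-- `Balanced` counts a, which is b in `swap ∘ w`. The bound is therefore obtained for `swap ∘ w`
-- first and exchanged back.
balanced⇒balancedCount : ∀ {w} → Balanced w → BalancedCount w
balanced⇒balancedCount {w} bal =
  balancedCount-cong (λ n → swap-involutive (w n)) (balancedCount-swap (balancedCount-from-windows windows))
  where
  A = countᵇ (swap ∘ w)
  windows : ∀ i j n → A (i + n) + A j ≤ suc (A (j + n) + A i)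
  windows i j n = begin
    A (i + n) + A j               ≡⟨ cong (_+ A j) (count-factor w i n) ⟨
    ∣ factor w i n ∣ₐ + A i + A j ≤⟨ +-monoˡ-≤ (A j) (+-monoˡ-≤ (A i) le) ⟩
    suc ∣ factor w j n ∣ₐ + A i + A j ≡⟨ cong suc (regroup ∣ factor w j n ∣ₐ (A i) (A j)) ⟩
    suc (∣ factor w j n ∣ₐ + A j + A i) ≡⟨ cong (λ m → suc (m + A i)) (count-factor w j n) ⟩
    suc (A (j + n) + A i)         ∎
    where
    open ≤-Reasoning
    regroup : ∀ x y z → x + y + z ≡ x + z + y
    regroup = solve-∀
    le : ∣ factor w i n ∣ₐ ≤ suc ∣ factor w j n ∣ₐ
    le = ≤-trans (m≤∣m-n∣+n ∣ factor w i n ∣ₐ ∣ factor w j n ∣ₐ)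
           (+-monoˡ-≤ _ (bal (factor w i n) (factor w j n) (factor-isFactor w i n) (factor-isFactor w j n)
             (trans (length-factor w i n) (sym (length-factor w j n)))))

-- Lyndon words are not covered.

covering : ∀ {ℓ} {q : ℕ → ℕ} → q 0 ≡ 0 → (∀ n → q n < q (suc n) × q (suc n) ≤ q n + ℓ) →
           ∀ m → ∃[ n ] (q n ≤ m × m < q n + ℓ)
covering q0≡0 step zero = 0 , ≤-reflexive q0≡0 ,
  ≤-trans (s≤s z≤n) (≤-trans (proj₁ (step 0)) (proj₂ (step 0)))
covering {ℓ} {q} q0≡0 step (suc m) with covering q0≡0 step m
... | n , qn≤m , m<qn+ℓ with m≤n⇒m<n∨m≡n m<qn+ℓ
...   | inj₁ 1+m<qn+ℓ = n , m≤n⇒m≤1+n qn≤m , 1+m<qn+ℓ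
-- `suc m` is the first position past the occurrence at `q n`. The next occurrence starts no later,
-- and it ends later because `q` increases.
...   | inj₂ 1+m≡qn+ℓ =
        suc n , ≤-trans (proj₂ (step n)) (≤-reflexive (sym 1+m≡qn+ℓ)) ,
        subst (_< q (suc n) + ℓ) (sym 1+m≡qn+ℓ) (+-monoˡ-< ℓ (proj₁ (step n)))

module _ {_≺_ : Rel Letter 0ℓ} (asym : Asymmetric _≺_) {w : ωWord}
         (lyndon : ∀ i → 0 < i → ∃[ l ] (OccursAt w l i × w l ≺ w (i + l)))
         where

  private
    irrefl : ∀ {x y} → x ≡ y → ¬ x ≺ y
    irrefl refl x≺x = asym x≺x x≺x

  -- The first difference is unique: one before `l` contradicts `occ`, one after `l` contradicts
  -- `occ′`, and at `l` itself the two comparisons contradict asymmetry.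
  no-greater-occurrence : ∀ i l → 0 < i → OccursAt w l i → ¬ w (i + l) ≺ w l
  no-greater-occurrence i l 0<i occ gt with lyndon i 0<i
  ... | m , occ′ , lt with <-cmp m l
  ...   | tri< m<l _ _  = irrefl (sym (occ m m<l)) lt
  ...   | tri≈ _ refl _ = asym gt lt
  ...   | tri> _ _ l<m  = irrefl (occ′ l l<m) gt

  -- Let w and its suffix at i first differ at i + l ≥ ℓ. The occurrence of the
  -- quasiperiod covering i + l cannot start after i, by minimality of w; if it
  -- starts at p < i, the suffix at p first differs beyond i + l: descend to p.
  lyndon⇒¬covered : ¬ Covered w
  -- Starting from the suffix at `suc ℓ`, the bound `ℓ ≤ i + l` holds wherever the first difference
  -- lies.
  lyndon⇒¬covered (ℓ , q , q0≡0 , step) = start (lyndon (suc ℓ) (s≤s z≤n))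
    where
    descend : ∀ i → 0 < i → ∀ l → OccursAt w l i → w l ≺ w (i + l) → ℓ ≤ i + l → ⊥
    descend = <-rec (λ i → 0 < i → ∀ l → OccursAt w l i → w l ≺ w (i + l) → ℓ ≤ i + l → ⊥) go
      where
      go : ∀ i → (∀ {j} → j < i → 0 < j → ∀ l → OccursAt w l j → w l ≺ w (j + l) → ℓ ≤ j + l → ⊥) →
           0 < i → ∀ l → OccursAt w l i → w l ≺ w (i + l) → ℓ ≤ i + l → ⊥
      go i rec 0<i l occ lt ℓ≤i+l
        with covering q0≡0 (λ n → proj₁ (step n) , proj₁ (proj₂ (step n))) (i + l)
      ... | n , p≤i+l , i+l<p+ℓ = cases (q n) p≤i+l i+l<p+ℓ (proj₂ (proj₂ (step n)))
        where
        cases : ∀ p → p ≤ i + l → i + l < p + ℓ → OccursAt w ℓ p → ⊥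
        cases p p≤i+l i+l<p+ℓ occₚ with <-cmp p i
        ... | tri≈ _ refl _ = irrefl (sym (occₚ l (+-cancelˡ-< p l ℓ i+l<p+ℓ))) lt
        ... | tri< p<i _ _ with p in p≡
        -- The occurrence at 0 ends before position `ℓ`, so it misses `i + l`; the bound carried
        -- through the descent serves this case.
        ...   | zero = contradiction i+l<p+ℓ (≤⇒≯ ℓ≤i+l)
        ...   | suc _ with lyndon p (subst (0 <_) (sym p≡) (s≤s z≤n))
        ...     | m , occₘ , ltₘ rewrite p≡ with <-≤-connex (i + l) (_ + m)
        ...       | inj₁ i+l<p+m = rec p<i (s≤s z≤n) m occₘ ltₘ (≤-trans ℓ≤i+l (<⇒≤ i+l<p+m))
        ...       | inj₂ p+m≤i+l =
                    irrefl (sym (occₚ m (+-cancelˡ-< _ m ℓ (≤-<-trans p+m≤i+l i+l<p+ℓ)))) ltₘ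
        -- With `p = i + e` and `l = e + f`, the prefix of length `f` occurs in `w` at `e`, and the
        -- letter after it is smaller than `w f`. So the suffix at `e` would be smaller than `w`.
        cases p p≤i+l i+l<p+ℓ occₚ | tri> _ _ i<p with m≤n⇒∃[o]m+o≡n (<⇒≤ i<p)
        ... | e , refl with m≤n⇒∃[o]m+o≡n (+-cancelˡ-≤ i e l p≤i+l)
        ...   | f , refl = no-greater-occurrence e f 0<e occₑ
                  (subst (w (e + f) ≺_) (trans (cong w (sym (+-assoc i e f))) (occₚ f f<ℓ)) lt)
          where
          0<e : 0 < e
          0<e = +-cancelˡ-< i 0 e (subst (_< i + e) (sym (+-identityʳ i)) i<p)
          f<ℓ : f < ℓ
          f<ℓ = +-cancelˡ-< (i + e) f ℓ (subst (_< i + e + ℓ) (sym (+-assoc i e f)) i+l<p+ℓ)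
          occₑ : OccursAt w f e
          occₑ t t<f = begin
            w (e + t)       ≡⟨ occ (e + t) (+-monoʳ-< e t<f) ⟨
            w (i + (e + t)) ≡⟨ cong w (+-assoc i e t) ⟨
            w (i + e + t)   ≡⟨ occₚ t (<-trans t<f f<ℓ) ⟩
            w t             ∎
            where open ≡-Reasoning
    start : ∃[ l ] (OccursAt w l (suc ℓ) × w l ≺ w (suc ℓ + l)) → ⊥
    start (l , occ , lt) = descend (suc ℓ) (s≤s z≤n) l occ lt (m≤n⇒m≤1+n (m≤m+n ℓ l))

lyndon⇒nonQuasiperiodic : ∀ {_≺_ : Rel Letter 0ℓ} {w} → Asymmetric _≺_ →
                          Lyndon _≺_ w → NonQuasiperiodic w
lyndon⇒nonQuasiperiodic {_≺_} {w} asym lyndon quasi =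
  lyndon⇒¬covered {_≺_} (λ {x} {y} → asym {x} {y}) at (quasiperiodic⇒covered quasi)
  where
  at : ∀ i → 0 < i → ∃[ l ] (OccursAt w l i × w l ≺ w (i + l))
  at i@(suc _) _ with lyndon (drop i w) (factor w 0 i , (λ ()) , drop≗factor⧺drop w 0 i)
  ... | l , eq , lt = l , (λ t t<l → sym (eq t t<l)) , lt

-- Desubstitution by a ↦ a, b ↦ ba, with monotonicity of the block positions.

increasing⇒mono-< : ∀ {f : ℕ → ℕ} → (∀ n → f n < f (suc n)) → ∀ {m n} → m < n → f m < f n
increasing⇒mono-< inc {m} {suc n} m<1+n with m<1+n⇒m<n∨m≡n m<1+n
... | inj₁ m<n  = <-trans (increasing⇒mono-< inc m<n) (inc n)
... | inj₂ refl = inc n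

increasing⇒mono-≤ : ∀ {f : ℕ → ℕ} → (∀ n → f n < f (suc n)) → ∀ {m n} → m ≤ n → f m ≤ f n
increasing⇒mono-≤ inc m≤n with m≤n⇒m<n∨m≡n m≤n
... | inj₁ m<n  = <⇒≤ (increasing⇒mono-< inc m<n)
... | inj₂ refl = ≤-refl

≤-bump : ∀ x n → n ≤ bump x n
≤-bump a n = ≤-refl
≤-bump b n = n≤1+n n

bump-≤ : ∀ x n → bump x n ≤ suc n
bump-≤ a n = n≤1+n n
bump-≤ b n = ≤-refl

bump-+ : ∀ x m n → bump x (m + n) ≡ m + bump x n
bump-+ a m n = refl
bump-+ b m n = sym (+-suc m n)

-- derived v is the word x with v = R(x), where R is the morphism a ↦ a, b ↦ ba;
-- blockStart v n is the length of R(x₀…xₙ₋₁).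
blockStart : ωWord → ℕ → ℕ
blockStart v zero    = 0
blockStart v (suc n) = suc (bump (v (blockStart v n)) (blockStart v n))

derived : ωWord → ωWord
derived v n = v (blockStart v n)

IsolatedB : ωWord → Set
IsolatedB v = ∀ n → v n ≡ b → v (suc n) ≡ a

module Desubstitution (v : ωWord) (isolated : IsolatedB v) where

  private
    x = derived v
    π = blockStart v
    B = countᵇ x
    C = countᵇ v

  π-increasing : ∀ n → π n < π (suc n)
  π-increasing n = s≤s (≤-bump _ _)

  n≤πn : ∀ n → n ≤ π n
  n≤πn zero    = z≤n
  n≤πn (suc n) = ≤-<-trans (n≤πn n) (π-increasing n)

  -- A block has one letter, and one more exactly when it is the image of b.
  πn≡n+count : ∀ n → π n ≡ n + B n
  πn≡n+count zero    = refl
  πn≡n+count (suc n) = cong suc (trans (cong (bump (x n)) (πn≡n+count n)) (bump-+ (x n) n (B n)))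

  count-π : ∀ n → C (π n) ≡ B n
  count-π zero = refl
  count-π (suc n) with v (π n) in eq
  ... | a = trans (cong (λ y → bump y (C (π n))) eq) (count-π n)
  ... | b = trans (cong₂ (λ y z → bump y (bump z (C (π n)))) (isolated (π n) eq) eq) (cong suc (count-π n))

  -- Both images, a and ba, end in a.
  block-end : ∀ n → ∃[ r ] (π (suc n) ≡ suc r × v r ≡ a)
  block-end n with v (π n) in eq
  ... | a = π n , refl , eq
  ... | b = suc (π n) , refl , isolated (π n) eq

  -- Blocks have at most two letters, so a position that starts no block is the second one of a
  -- block ba. The base point `π N` serves words whose period is known only from `N` on.
  position-from : ∀ N d →
    ∃[ k ] (d + π N ≡ π (k + N) ⊎ (d + π N ≡ suc (π (k + N)) × x (k + N) ≡ b))
  position-from N zero = 0 , inj₁ refl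
  position-from N (suc d) with position-from N d
  ... | k , inj₂ (eq , xk≡b) = suc k , inj₁ (cong suc (trans eq (cong (λ y → bump y (π (k + N))) (sym xk≡b))))
  ... | k , inj₁ eq with x (k + N) in xk
  ...   | a = suc k , inj₁ (cong suc (trans eq (cong (λ y → bump y (π (k + N))) (sym xk))))
  ...   | b = k , inj₂ (cong suc eq , xk)

  position : ∀ i → ∃[ n ] (i ≡ π n ⊎ (i ≡ suc (π n) × x n ≡ b))
  position i with position-from 0 i
  ... | k , p rewrite +-identityʳ i | +-identityʳ k = k , p

  -- Since `π n` exceeds `n` by the number of blocks ba, equality leaves only blocks a.
  initial-block : ∀ n → π n ≡ n → ∀ t → t < n → v t ≡ a
  initial-block (suc n) eq t t<1+n with v (π n) in vπn
  ... | b = contradiction (suc-injective eq) (>⇒≢ (s≤s (n≤πn n)))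
  ... | a with m<1+n⇒m<n∨m≡n t<1+n
  ...   | inj₁ t<n  = initial-block n (suc-injective eq) t t<n
  ...   | inj₂ refl = trans (cong v (sym (suc-injective eq))) vπn

  -- The balance bound for v[i..e) against a v[k..f), where v[k..f) is one letter shorter and the
  -- added a contributes nothing to the count. For `k = 0` it speaks of an a put in front of `v`.
  PrecededByA : ℕ → Set
  PrecededByA k = ∀ e f i → e + k ≡ suc (f + i) → C e + C k ≤ suc (C f + C i)

  block-precededByA : BalancedCount v → ∀ n → PrecededByA (π (suc n))
  block-precededByA bal n with block-end n
  ... | r , eq , vr≡a = subst PrecededByA (sym eq) λ e f i e+1+r≡1+f+i →
    subst (λ y → C e + bump y (C r) ≤ suc (C f + C i)) (sym vr≡a)
      (bal e f i r (suc-injective (trans (sym (+-suc e r)) e+1+r≡1+f+i)))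

  -- An imbalance by 2 between the windows at i and j would give one in v: drop
  -- the final a of the image of the former, prepend an a to that of the latter.
  derived-window : ∀ i j → PrecededByA (π j) → ∀ n → B (i + n) + B j ≤ suc (B (j + n) + B i)
  derived-window i j prec zero rewrite +-identityʳ i | +-identityʳ j =
    m≤n⇒m≤1+n (≤-reflexive (+-comm (B i) (B j)))
  derived-window i j prec (suc n) rewrite +-suc i n | +-suc j n
    with derived-window i j prec n
  ... | ih with x (i + n) in xi | x (j + n) in xj
  ...   | a | a = ih
  ...   | a | b = m≤n⇒m≤1+n ih
  ...   | b | b = s≤s ih
  ...   | b | a with m≤n⇒m<n∨m≡n ih
  ...     | inj₁ lt = lt
  ...     | inj₂ eq = subst₂ _≤_
              (cong₂ _+_ (count-suc xi) (count-π j))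
              (cong suc (cong₂ _+_ (count-suc xj) (count-π i)))
              (prec (suc (π (i + n))) (suc (π (j + n))) (π i) (cong suc lengths))
    where
    count-suc : ∀ {y m} → x m ≡ y → C (suc (π m)) ≡ bump y (B m)
    count-suc {m = m} xm≡y = cong₂ bump xm≡y (count-π m)
    regroup : ∀ p q r s t → p + q + r + (s + t) ≡ p + s + q + (r + t)
    regroup = solve-∀
    regroup′ : ∀ p q r s t → p + s + q + suc (r + t) ≡ suc (s + q + r + (p + t))
    regroup′ = solve-∀
    lengths : π (i + n) + π j ≡ suc (π (j + n) + π i)
    lengths = begin
      π (i + n) + π j                       ≡⟨ cong₂ _+_ (πn≡n+count (i + n)) (πn≡n+count j) ⟩
      i + n + B (i + n) + (j + B j)         ≡⟨ regroup i n (B (i + n)) j (B j) ⟩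
      i + j + n + (B (i + n) + B j)         ≡⟨ cong (i + j + n +_) eq ⟩
      i + j + n + suc (B (j + n) + B i)     ≡⟨ regroup′ i n (B (j + n)) j (B i) ⟩
      suc (j + n + B (j + n) + (i + B i))   ≡⟨ cong suc (cong₂ _+_ (πn≡n+count (j + n)) (πn≡n+count i)) ⟨
      suc (π (j + n) + π i)                 ∎
      where open ≡-Reasoning

  derived-balanced : BalancedCount v → PrecededByA 0 ⊎ v 0 ≡ b → BalancedCount x
  derived-balanced bal start = balancedCount-from-windows (window start)
    where
    window : PrecededByA 0 ⊎ v 0 ≡ b → ∀ i j n → B (i + n) + B j ≤ suc (B (j + n) + B i)
    window _           i (suc j) n    = derived-window i (suc j) (block-precededByA bal j) n
    window (inj₁ prec) i zero    n    = derived-window i 0 prec n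
    window (inj₂ v0≡b) i zero    zero rewrite +-identityʳ i = m≤n⇒m≤1+n (≤-reflexive (+-comm (B i) 0))
    -- No block precedes position 0, so the first letters are removed from both windows. The one at
    -- 0 loses a b and the other at most one, so the bound for the windows at 1 and `suc i`
    -- suffices.
    window (inj₂ v0≡b) i zero (suc n) = s≤s⁻¹ (begin
      suc (B (i + suc n) + 0)          ≡⟨ +-suc (B (i + suc n)) 0 ⟨
      B (i + suc n) + 1                ≡⟨ cong₂ _+_ (cong B (+-suc i n)) (cong (λ y → bump y 0) (sym v0≡b)) ⟩
      B (suc i + n) + B 1              ≤⟨ derived-window (suc i) 1 (block-precededByA bal 0) n ⟩
      suc (B (suc n) + B (suc i))      ≤⟨ s≤s (+-monoʳ-≤ (B (suc n)) (bump-≤ (x i) (B i))) ⟩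
      suc (B (suc n) + suc (B i))      ≡⟨ cong suc (+-suc (B (suc n)) (B i)) ⟩
      suc (suc (B (suc n) + B i))      ∎)
      where open ≤-Reasoning

  -- The image of one period of `x` has length `suc P` and is a period of `v` from `π N` on.
  derived-eventuallyPeriodic : EventuallyPeriodic x → EventuallyPeriodic v
  derived-eventuallyPeriodic (N , p , per)
    with m≤n⇒∃[o]m+o≡n (increasing⇒mono-< π-increasing (m<m+n N {suc p} (s≤s z≤n)))
  ... | P , eqP = π N , P , periodic
    where
    open ≡-Reasoning
    π-period : ∀ d → π (d + N + suc p) ≡ π (d + N) + suc P
    π-period zero    = trans (sym eqP) (sym (+-suc (π N) P))
    π-period (suc d) = cong suc (begin
      bump (x (d + N + suc p)) (π (d + N + suc p)) ≡⟨ cong₂ bump (per d) (π-period d) ⟩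
      bump (x (d + N)) (π (d + N) + suc P)         ≡⟨ cong (bump (x (d + N))) (+-comm (π (d + N)) (suc P)) ⟩
      bump (x (d + N)) (suc P + π (d + N))         ≡⟨ bump-+ (x (d + N)) (suc P) (π (d + N)) ⟩
      suc P + bump (x (d + N)) (π (d + N))         ≡⟨ +-comm (suc P) _ ⟩
      bump (x (d + N)) (π (d + N)) + suc P         ∎)
    periodic : ∀ d → v (d + π N + suc P) ≡ v (d + π N)
    periodic d with position-from N d
    ... | k , inj₁ eq rewrite eq = trans (cong v (sym (π-period k))) (per k)
    ... | k , inj₂ (eq , xk≡b) rewrite eq | sym (π-period k) =
      trans (isolated _ (trans (per k) xk≡b)) (sym (isolated _ xk≡b))

  -- Equal words have images of equal length, here the prefix of length `t` and its occurrence at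
  -- `n`.
  π-additive : ∀ {ℓ n} → OccursAt x ℓ n → ∀ t → t ≤ ℓ → π (n + t) ≡ π n + π t
  π-additive {n = n} occ zero _ = trans (cong π (+-identityʳ n)) (sym (+-identityʳ (π n)))
  π-additive {n = n} occ (suc t) t<ℓ = begin
    π (n + suc t)                            ≡⟨ cong π (+-suc n t) ⟩
    suc (bump (x (n + t)) (π (n + t)))       ≡⟨ cong suc (cong₂ bump (occ t t<ℓ) (π-additive occ t (<⇒≤ t<ℓ))) ⟩
    suc (bump (x t) (π n + π t))             ≡⟨ cong suc (bump-+ (x t) (π n) (π t)) ⟩
    suc (π n + bump (x t) (π t))             ≡⟨ +-suc (π n) _ ⟨
    π n + π (suc t)                          ∎
    where open ≡-Reasoning

  occursAt-image : ∀ {ℓ n} → OccursAt x ℓ n → OccursAt v (π ℓ) (π n)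
  occursAt-image {ℓ} {n} occ s s<πℓ with position s
  ... | k , inj₁ refl = trans (cong v (sym (π-additive occ k (<⇒≤ k<ℓ)))) (occ k k<ℓ)
    where
    k<ℓ : k < ℓ
    k<ℓ = ≰⇒> λ ℓ≤k → <⇒≱ s<πℓ (increasing⇒mono-≤ π-increasing ℓ≤k)
  ... | k , inj₂ (refl , xk≡b) =
    trans (trans (cong v shift) (isolated _ (trans (occ k k<ℓ) xk≡b))) (sym (isolated _ xk≡b))
    where
    k<ℓ : k < ℓ
    k<ℓ = ≰⇒> λ ℓ≤k → <⇒≱ (<-trans (n<1+n (π k)) s<πℓ) (increasing⇒mono-≤ π-increasing ℓ≤k)
    shift : π n + suc (π k) ≡ suc (π (n + k))
    shift = trans (+-suc (π n) (π k)) (cong suc (sym (π-additive occ k (<⇒≤ k<ℓ))))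

  -- `w` is kept apart from `v` so that both w = R(x) and w = a R(x) are served. Additivity of `π`
  -- along an occurrence carries over the bound on the gaps.
  covered-image : ∀ {w} → (∀ {ℓ n} → OccursAt x ℓ n → OccursAt w (π ℓ) (π n)) →
                  Covered x → Covered w
  covered-image image (ℓ , q , q0≡0 , step) = π ℓ , π ∘ q , cong π q0≡0 , λ n →
    increasing⇒mono-< π-increasing (proj₁ (step n)) ,
    ≤-trans (increasing⇒mono-≤ π-increasing (proj₁ (proj₂ (step n))))
            (≤-reflexive (π-additive (proj₂ (proj₂ (step n))) ℓ ≤-refl)) ,
    image (proj₂ (proj₂ (step n)))

-- Regular words and comparison with a suffix.

≢swap⇒≡ : ∀ {x y} → y ≢ swap x → y ≡ x
≢swap⇒≡ {a} {a} _     = refl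
≢swap⇒≡ {a} {b} y≢    = contradiction refl y≢
≢swap⇒≡ {b} {a} y≢    = contradiction refl y≢
≢swap⇒≡ {b} {b} _     = refl

swap≢ : ∀ {x} → swap x ≢ x
swap≢ {a} ()
swap≢ {b} ()

count-run : ∀ {w} k n → (∀ t → t < n → w (t + k) ≡ a) → countᵇ w (n + k) ≡ countᵇ w k
count-run         k zero    run = refl
count-run {w}     k (suc n) run =
  trans (cong (λ y → bump y (countᵇ w (n + k))) (run n ≤-refl))
        (count-run k n λ t t<n → run t (m<n⇒m<1+n t<n))

countᵇ-mono : ∀ {w} n k → countᵇ w k ≤ countᵇ w (n + k)
countᵇ-mono zero    k = ≤-refl
countᵇ-mono {w} (suc n) k = ≤-trans (countᵇ-mono n k) (≤-bump (w (n + k)) _)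

-- w and its suffix at i first differ at a place where w carries its first letter x,
-- that is, w is smaller than that suffix for the order in which x comes first.
BelowSuffix : ωWord → ℕ → Set
BelowSuffix w i = ∃[ l ] (OccursAt w l i × w l ≡ w 0 × w (i + l) ≢ w 0)

belowSuffix-unswap : ∀ {w i} → BelowSuffix (swap ∘ w) i → BelowSuffix w i
belowSuffix-unswap (l , occ , eq , neq) =
  l , (λ t t<l → swap-injective (occ t t<l)) , swap-injective eq , neq ∘ cong swap

-- Sturmian and not quasiperiodic, by positions: the class of words on which the induction runs.
Regular : ωWord → Set
Regular w = BalancedCount w × ¬ EventuallyPeriodic w × ¬ Covered w

regular-swap : ∀ {w} → Regular w → Regular (swap ∘ w)
regular-swap (bal , aper , ¬cov) =
  balancedCount-swap bal ,
  (λ (N , p , per) → aper (N , p , λ d → swap-injective (per d))) ,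
  λ (ℓ , q , q0≡0 , step) → ¬cov (ℓ , q , q0≡0 , λ n →
    proj₁ (step n) , proj₁ (proj₂ (step n)) , λ t t<ℓ → swap-injective (proj₂ (proj₂ (step n)) t t<ℓ))

-- Otherwise bb and aa are both factors, and their counts of b differ by 2.
bb⇒aa-free : ∀ {w} → BalancedCount w → ∀ k → w k ≡ b → w (suc k) ≡ b →
             IsolatedB (swap ∘ w)
bb⇒aa-free {w} bal k wk wk+1 n wn with w n in eqn | w (suc n) in eqn+1
... | a | b = refl
... | a | a = contradiction
  (begin
    suc (suc (B k + B n))         ≡⟨ cong (_+ B n) (cong₂ (λ y z → bump y (bump z (B k))) wk+1 wk) ⟨
    B (suc (suc k)) + B n         ≤⟨ bal (suc (suc k)) (suc (suc n)) k n (cong (λ m → suc (suc m)) (+-comm k n)) ⟩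
    suc (B (suc (suc n)) + B k)   ≡⟨ cong (λ m → suc (m + B k)) (cong₂ (λ y z → bump y (bump z (B n))) eqn+1 eqn) ⟩
    suc (B n + B k)               ≡⟨ cong suc (+-comm (B n) (B k)) ⟩
    suc (B k + B n)               ∎)
  1+n≰n
  where
  open ≤-Reasoning
  B = countᵇ w

-- First occurrences, initial runs and the prefix ab.

module Classical (em : ExcludedMiddle 0ℓ) where

  least : ∀ {P : ℕ → Set} n → P n → ∃[ m ] (P m × (∀ k → k < m → ¬ P k))
  least {P} = <-rec (λ n → P n → ∃[ m ] (P m × (∀ k → k < m → ¬ P k))) go
    where
    go : ∀ n → (∀ {k} → k < n → P k → ∃[ m ] (P m × (∀ k → k < m → ¬ P k))) →
         P n → ∃[ m ] (P m × (∀ k → k < m → ¬ P k))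
    go n rec Pn with em {∃[ k ] (k < n × P k)}
    ... | yes (k , k<n , Pk) = rec k<n Pk
    ... | no none            = n , Pn , λ k k<n Pk → none (k , k<n , Pk)

  -- A tail that avoids one letter is constant, hence has period 1.
  recurs : ∀ {w} → ¬ EventuallyPeriodic w → ∀ x N → ∃[ d ] w (d + N) ≡ x
  recurs {w} aper x N with em {∃[ d ] w (d + N) ≡ x}
  ... | yes found = found
  ... | no none   = contradiction (N , 0 , λ d →
          trans (cong w (+-comm (d + N) 1)) (trans (other (suc d)) (sym (other d)))) aper
    where
    other : ∀ d → w (d + N) ≡ swap x
    other d = ≢swap⇒≡ λ eq → none (d , trans eq (swap-involutive x))

  -- If the first change of letter is at `k = i + l`, the suffix at `i` changes after `l` letters,
  -- while `w` still carries its first letter there.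
  belowSuffix-run : ∀ {w} → ¬ EventuallyPeriodic w → ∀ i → 0 < i →
                    (∀ t → t < i → w t ≡ w 0) → BelowSuffix w i
  belowSuffix-run {w} aper i 0<i run with recurs {w} aper (swap (w 0)) 0
  ... | d , wd with least {λ k → w k ≡ swap (w 0)} (d + 0) wd
  ...   | k , wk , before
          with m≤n⇒∃[o]m+o≡n (≮⇒≥ λ k<i → swap≢ (trans (sym wk) (run k k<i)))
  ...     | l , refl = l , (λ t t<l → trans (same (i + t) (+-monoʳ-< i t<l)) (sym (same t (<-trans t<l l<i+l)))) ,
                       same l l<i+l , λ eq → swap≢ (trans (sym wk) eq)
    where
    l<i+l : l < i + l
    l<i+l = m<n+m l 0<i
    same : ∀ t → t < i + l → w t ≡ w 0
    same t t<k = ≢swap⇒≡ (before t t<k)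

  -- With 1 + d the least distance between two occurrences of b, consecutive
  -- occurrences are at distance 1 + d or 2 + d, and a b aᵈ is a quasiperiod.
  ab-prefix⇒covered : ∀ {w} → BalancedCount w → ¬ EventuallyPeriodic w → IsolatedB w →
                      w 0 ≡ a → w 1 ≡ b → Covered w
  ab-prefix⇒covered {w} bal aper isolated w0 w1 with recurs {w} aper b 2
  ... | d₀ , wd₀ with least {λ d → ∃[ k ] (w (suc k) ≡ b × w (suc d + suc k) ≡ b)} d₀
                       (0 , w1 , trans (cong w (sym (+-suc d₀ 1))) wd₀)
  ...   | d , (k₀ , wk₀ , wk₀+d) , minimal =
    suc (suc d) , proj₁ ∘ pos , refl , λ n →
      proj₁ (proj₂ (proj₂ (next (pos n)))) , proj₂ (proj₂ (proj₂ (next (pos n)))) ,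
      occ (proj₁ (pos n)) (proj₂ (pos n))
    where
    B = countᵇ w
    after : ∀ k → w (suc k) ≡ b → ∀ t → t < d → w (suc t + suc k) ≡ a
    after k wk t t<d = ≢swap⇒≡ λ eq → minimal t t<d (k , wk , eq)

    -- Otherwise the 2 + d letters after this b are all a, whereas the window of the same length at
    -- `suc k₀` contains two b.
    after₂ : ∀ k → w (suc k) ≡ b → w (suc d + suc k) ≢ b → w (suc (suc d) + suc k) ≡ b
    after₂ k wk ≢b = ≢swap⇒≡ λ eq → contradiction
      (begin
        suc (suc (B (suc k₀))) + B (suc (suc k))  ≤⟨ +-monoˡ-≤ (B (suc (suc k))) two ⟩
        B (suc (suc d) + suc k₀) + B (suc (suc k))
          ≤⟨ bal (suc (suc d) + suc k₀) (suc (suc d) + suc (suc k)) (suc k₀) (suc (suc k)) (lengths d k₀ k) ⟩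
        suc (B (suc (suc d) + suc (suc k)) + B (suc k₀))
          ≡⟨ cong (λ m → suc (m + B (suc k₀))) (count-run {w} (suc (suc k)) (suc (suc d)) (run eq)) ⟩
        suc (B (suc (suc k)) + B (suc k₀))        ≡⟨ cong suc (+-comm (B (suc (suc k))) (B (suc k₀))) ⟩
        suc (B (suc k₀) + B (suc (suc k)))        ∎)
      1+n≰n
      where
      open ≤-Reasoning
      lengths : ∀ p q r → suc (suc p) + suc q + suc (suc r) ≡ suc (suc p) + suc (suc r) + suc q
      lengths = solve-∀
      two : suc (suc (B (suc k₀))) ≤ B (suc (suc d) + suc k₀)
      two = begin
        suc (suc (B (suc k₀)))           ≡⟨ cong (λ y → suc (bump y (B (suc k₀)))) wk₀ ⟨
        suc (B (suc (suc k₀)))           ≤⟨ s≤s (countᵇ-mono {w} d (suc (suc k₀))) ⟩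
        suc (B (d + suc (suc k₀)))       ≡⟨ cong (suc ∘ B) (+-suc d (suc k₀)) ⟩
        bump b (B (suc d + suc k₀))      ≡⟨ cong (λ y → bump y (B (suc d + suc k₀))) wk₀+d ⟨
        B (suc (suc d) + suc k₀)         ∎
      run : w (suc (suc d) + suc k) ≡ a → ∀ t → t < suc (suc d) → w (t + suc (suc k)) ≡ a
      run eq t t<2+d = trans (cong w (+-suc t (suc k))) (cases (m<1+n⇒m<n∨m≡n t<2+d))
        where
        cases : t < suc d ⊎ t ≡ suc d → w (suc t + suc k) ≡ a
        cases (inj₂ refl) = eq
        cases (inj₁ t<1+d) with m<1+n⇒m<n∨m≡n t<1+d
        ... | inj₁ t<d  = after k wk t t<d
        ... | inj₂ refl = ≢swap⇒≡ ≢b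

    next : ((x , _) : ∃[ x ] w (suc x) ≡ b) → ∃[ y ] (w (suc y) ≡ b × x < y × y ≤ x + suc (suc d))
    next (x , wx) with em {w (suc d + suc x) ≡ b}
    ... | yes eq = suc d + x , trans (cong w (sym (+-suc (suc d) x))) eq ,
                   s≤s (m≤n+m x d) ,
                   ≤-trans (n≤1+n _) (≤-reflexive (+-comm (suc (suc d)) x))
    ... | no neq = suc (suc d) + x , trans (cong w (sym (+-suc (suc (suc d)) x))) (after₂ x wx neq) ,
                   s≤s (m≤n+m x (suc d)) , ≤-reflexive (+-comm (suc (suc d)) x)

    pos : ℕ → ∃[ x ] w (suc x) ≡ b
    pos zero    = 0 , w1
    pos (suc n) = let y , wy , _ = next (pos n) in y , wy

    -- The letter before a b is a because b is isolated, and the d letters after it are a by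
    -- minimality of `d`.
    occ : ∀ x → w (suc x) ≡ b → OccursAt w (suc (suc d)) x
    occ x wx zero _ = trans (cong w (+-identityʳ x)) (trans wx≡a (sym w0))
      where
      wx≡a : w x ≡ a
      wx≡a = ≢swap⇒≡ λ wx≡b → contradiction (trans (sym wx) (isolated x wx≡b)) λ ()
    occ x wx (suc zero) _ = trans (cong w (+-comm x 1)) (trans wx (sym w1))
    occ x wx (suc (suc t)) (s≤s (s≤s t<d)) = begin
      w (x + suc (suc t))  ≡⟨ cong w (shift x t) ⟩
      w (suc t + suc x)    ≡⟨ after x wx t t<d ⟩
      a                    ≡⟨ after 0 w1 t t<d ⟨
      w (suc t + 1)        ≡⟨ cong w (+-comm (suc t) 1) ⟩
      w (suc (suc t))      ∎
      where
      open ≡-Reasoning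
      shift : ∀ x t → x + suc (suc t) ≡ suc t + suc x
      shift = solve-∀

  -- The induction step for words without bb.

  module _ {w} (regular : Regular w) (isolated : IsolatedB w) (i : ℕ) (0<i : 0 < i)
           (rec : ∀ {j} → j < i → 0 < j → ∀ {x} → Regular x → BelowSuffix x j)
           where

    private
      bal  = proj₁ regular
      aper = proj₁ (proj₂ regular)
      ¬cov = proj₂ (proj₂ regular)

    belowSuffix-b : w 0 ≡ b → BelowSuffix w i
    belowSuffix-b w0 = cases (position i)
      where
      open Desubstitution w isolated
      π = blockStart w
      x = derived w
      regularₓ : Regular x
      regularₓ = derived-balanced bal (inj₂ w0) , aper ∘ derived-eventuallyPeriodic ,
                 ¬cov ∘ covered-image occursAt-image
      -- The first block is ba, so every later block has an index below its position and the
      -- induction descends.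
      n<πn : ∀ n → 0 < n → n < π n
      n<πn (suc zero)    _ = ≤-reflexive (cong (λ y → suc (bump y 0)) (sym w0))
      n<πn (suc (suc n)) _ = ≤-<-trans (n<πn (suc n) (s≤s z≤n)) (π-increasing (suc n))
      cases : ∃[ n ] (i ≡ π n ⊎ (i ≡ suc (π n) × x n ≡ b)) → BelowSuffix w i
      -- The suffix starts inside a block ba, hence with a, and differs from `w` at once.
      cases (n , inj₂ (refl , xn)) =
        0 , (λ _ ()) , refl , λ eq →
          contradiction (trans (sym w0) (trans (sym eq) (trans (cong w (+-identityʳ _)) (isolated (π n) xn)))) λ ()
      cases (zero , inj₁ refl) = contradiction 0<i λ ()
      cases (n@(suc _) , inj₁ refl) with rec (n<πn n (s≤s z≤n)) (s≤s z≤n) regularₓ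
      ... | l , occ , xl , xn+l =
        π l , occursAt-image occ , xl , λ eq → xn+l (trans (cong w (π-additive occ l ≤-refl)) eq)

    belowSuffix-a : w 0 ≡ a → BelowSuffix w i
    belowSuffix-a w0 with w 1 in w1
    ... | b = contradiction (ab-prefix⇒covered bal aper isolated w0 w1) ¬cov
    ... | a = cases (position i)
      where
      v = w ∘ suc
      open Desubstitution v (isolated ∘ suc)
      π = blockStart v
      x = derived v

      count-tail : ∀ n → countᵇ w (suc n) ≡ countᵇ v n
      count-tail zero    = cong (λ y → bump y 0) w0
      count-tail (suc n) = cong (bump (v n)) (count-tail n)

      -- `k` remains a position of `w`: `k = 0` puts the first a of `w` in front of `v` and gives
      -- `PrecededByA 0`, while `k = suc j` gives the balance of `v`.
      bal-tail : ∀ e f i k → e + k ≡ suc (f + i) →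
                 countᵇ v e + countᵇ w k ≤ suc (countᵇ v f + countᵇ v i)
      bal-tail e f i k eq =
        subst₂ _≤_ (cong (_+ countᵇ w k) (count-tail e)) (cong suc (cong₂ _+_ (count-tail f) (count-tail i)))
          (bal (suc e) (suc f) (suc i) k (cong suc (trans eq (sym (+-suc f i)))))

      balᵥ : BalancedCount v
      balᵥ e f i j eq = subst (λ m → countᵇ v e + m ≤ suc (countᵇ v f + countᵇ v i)) (count-tail j)
        (bal-tail e f i (suc j) (trans (+-suc e j) (cong suc eq)))

      aperᵥ : ¬ EventuallyPeriodic v
      aperᵥ (N , p , per) = aper (suc N , p , λ d →
        trans (cong (λ m → w (m + suc p)) (+-suc d N)) (trans (per d) (cong w (sym (+-suc d N)))))

      -- Positions in `w` are shifted by one against `v`, so this is the last letter of the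
      -- preceding block, or the first letter of `w`. Hence the suffix of `w` at `π n` is a followed
      -- by the image of the suffix of `x` at `n`.
      block-starts-with-a : ∀ n → w (π n) ≡ a
      block-starts-with-a zero    = w0
      block-starts-with-a (suc n) with block-end n
      ... | r , eq , vr≡a = trans (cong w eq) vr≡a

      occursAt-image⁺ : ∀ {ℓ n} → OccursAt x ℓ n → OccursAt w (suc (π ℓ)) (π n)
      occursAt-image⁺ {n = n} occ zero _ =
        trans (cong w (+-identityʳ (π n))) (trans (block-starts-with-a n) (sym w0))
      occursAt-image⁺ {n = n} occ (suc t) (s≤s t<πℓ) =
        trans (cong w (+-suc (π n) t)) (occursAt-image occ t t<πℓ)

      regularₓ : Regular x
      regularₓ = derived-balanced balᵥ (inj₁ λ e f i → bal-tail e f i 0) ,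
                 aperᵥ ∘ derived-eventuallyPeriodic ,
                 ¬cov ∘ covered-image λ occ t t<πℓ → occursAt-image⁺ occ t (m<n⇒m<1+n t<πℓ)

      cases : ∃[ n ] (i ≡ π n ⊎ (i ≡ suc (π n) × x n ≡ b)) → BelowSuffix w i
      cases (n , inj₂ (refl , xn)) =
        0 , (λ _ ()) , refl , λ eq →
          contradiction (trans (sym w0) (trans (sym eq) (trans (cong w (+-identityʳ _)) xn))) λ ()
      cases (zero , inj₁ refl) = contradiction 0<i λ ()
      cases (n@(suc n-1) , inj₁ refl) with m≤n⇒m<n∨m≡n (n≤πn n)
      -- Here `i` equals `n`, so the induction does not descend; but the first `n` blocks are all a,
      -- and `w` starts with a run reaching past `i`.
      ... | inj₂ n≡πn = belowSuffix-run aper i 0<i run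
        where
        run : ∀ t → t < π n → w t ≡ w 0
        run zero    _    = refl
        run (suc t) t<πn = trans (initial-block n (sym n≡πn) t
          (<-trans (n<1+n t) (subst (suc t <_) (sym n≡πn) t<πn))) (sym w0)
      ... | inj₁ n<πn with rec n<πn (s≤s z≤n) regularₓ
      ...   | l , occ , xl , xn+l =
        -- The common prefix is the leading a and the image of the first `l` letters of `x`; the
        -- letters after it start blocks and are those compared in `x`.
        suc (π l) , occursAt-image⁺ occ , trans xl (trans w1 (sym w0)) , λ eq →
          xn+l (trans (cong v (π-additive occ l ≤-refl))
            (trans (cong w (sym (+-suc (π n) (π l)))) (trans eq (trans w0 (sym w1)))))

    belowSuffix-isolated : BelowSuffix w i
    belowSuffix-isolated = split (w 0) refl
      where
      split : ∀ x → w 0 ≡ x → BelowSuffix w i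
      split a = belowSuffix-a
      split b = belowSuffix-b

  -- The induction is on the position, for all regular words at once, because each step changes the
  -- word: to `derived`, after an exchange of letters if bb occurs.
  regular⇒belowSuffix : ∀ i → 0 < i → ∀ {w} → Regular w → BelowSuffix w i
  regular⇒belowSuffix = <-rec (λ i → 0 < i → ∀ {w} → Regular w → BelowSuffix w i) go
    where
    go : ∀ i → (∀ {j} → j < i → 0 < j → ∀ {w} → Regular w → BelowSuffix w j) →
         0 < i → ∀ {w} → Regular w → BelowSuffix w i
    go i rec 0<i {w} regular with em {∃[ k ] (w k ≡ b × w (suc k) ≡ b)}
    ... | yes (k , wk , wk+1) = belowSuffix-unswap
      (belowSuffix-isolated (regular-swap regular) (bb⇒aa-free (proj₁ regular) k wk wk+1) i 0<i rec)
    ... | no bb-free = belowSuffix-isolated regular isolated i 0<i rec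
      where
      isolated : IsolatedB w
      isolated n wn = ≢swap⇒≡ λ wn+1 → bb-free (n , wn , wn+1)

-- The equivalence for Sturmian words.

theorem6p5 : ExcludedMiddle 0ℓ → (w : ωWord) → Sturmian w →
    NonQuasiperiodic w ⇔ (Lyndon _≺ᵃᵇ_ w ⊎ Lyndon _≺ᵇᵃ_ w)
theorem6p5 em w (balanced , aperiodic) = mk⇔ to from
  where
  open Classical em
  from : Lyndon _≺ᵃᵇ_ w ⊎ Lyndon _≺ᵇᵃ_ w → NonQuasiperiodic w
  from (inj₁ lyndon) = lyndon⇒nonQuasiperiodic {_≺ᵃᵇ_} (λ { a≺b () }) lyndon
  from (inj₂ lyndon) = lyndon⇒nonQuasiperiodic {_≺ᵇᵃ_} (λ { a≺b () }) lyndon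

  to : NonQuasiperiodic w → Lyndon _≺ᵃᵇ_ w ⊎ Lyndon _≺ᵇᵃ_ w
  to ¬quasi = orient (w 0) refl
    where
    regular : Regular w
    regular = balanced⇒balancedCount balanced ,
              aperiodic ∘ eventuallyPeriodic⇒ultimatelyPeriodic ,
              ¬quasi ∘ covered⇒quasiperiodic

    -- `BelowSuffix` becomes a lexicographic comparison for any order in which `w 0` is the smaller
    -- letter.
    lyndon : (_≺_ : Rel Letter 0ℓ) → (∀ {y} → y ≢ w 0 → w 0 ≺ y) → Lyndon _≺_ w
    lyndon _≺_ minimal w′ ([] , u≢[] , _) = contradiction refl u≢[]
    lyndon _≺_ minimal w′ (u@(_ ∷ _) , _ , w≗u⧺w′)
      with regular⇒belowSuffix (length u) (s≤s z≤n) regular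
    ... | l , occ , wl , wi+l =
      l , (λ t t<l → trans (sym (occ t t<l)) (suffix t)) ,
      subst₂ _≺_ (sym wl) (suffix l) (minimal wi+l)
      where
      suffix : ∀ t → w (length u + t) ≡ w′ t
      suffix t = trans (w≗u⧺w′ (length u + t)) (⧺-drop u w′ t)

    orient : ∀ x → w 0 ≡ x → Lyndon _≺ᵃᵇ_ w ⊎ Lyndon _≺ᵇᵃ_ w
    orient a w0 = inj₁ (lyndon _≺ᵃᵇ_ λ
      { {a} y≢ → contradiction (sym w0) y≢ ; {b} _ → subst (_≺ᵃᵇ b) (sym w0) a≺b })
    orient b w0 = inj₂ (lyndon _≺ᵇᵃ_ λ
      { {a} _ → subst (_≺ᵇᵃ a) (sym w0) a≺b ; {b} y≢ → contradiction (sym w0) y≢ })
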